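{- Every (nonempty) skeletal digraph is peo-consistent.
   Context: Digraphs are finite, without loops, parallel or antiparallel arcs. The transitive reduction of a digraph is obtained by removing all arcs $u\to v$ for which there is another directed path (of length at least $2$) from $u$ to $v$. An oriented forest is a digraph whose underlying undirected graph is a forest. A digraph $D$ is vertebrate if the transitive reduction of every induced subgraph of $D$ is an oriented forest (such $D$ is necessarily acyclic). A digraph $D$ is filled if for any directed path $v_1\to\cdots\to v_k$ in $D$, if the arc $v_1\to v_k$ belongs to $D$, then all arcs $v_i\to v_j$, $1\le i<j\le k$, belong to $D$. A digraph is skeletal if it is both vertebrate and filled. A digraph $D$ is peo-consistent if its vertices can be labeled $1,\ldots,n$ such that either $n=1$, or (i) the vertex $n$ is a source or a sink of $D$ (all arcs incident with it are outgoing, or all are incoming), (ii) the vertex $n$ is simplicial in the underlying undirected graph of $D$ (its neighborhood is a clique), and (iii) $D-n$ (with the labels $1,\ldots,n-1$) is peo-consistent. -}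

module Defs where

open import Data.Empty using (⊥-elim)
open import Data.Fin.Base using (Fin; zero; suc; inject₁; fromℕ)
open import Data.Fin.Permutation using (Permutation′)
open import Data.Fin.Properties using (any?; inject₁-injective; injective⇒≤)
import Data.Fin.Properties as Fin
open import Data.List.Base using (List; []; _∷_; _∷ʳ_; length; lookup)
open import Data.List.Membership.Propositional using (_∈_)
open import Data.List.Membership.Propositional.Properties using (∈-lookup)
open import Data.List.Properties using (length-++)
import Data.List.Relation.Unary.All as All
open import Data.List.Relation.Unary.AllPairs using (AllPairs; _∷_)
open import Data.List.Relation.Unary.Linked using (Linked; linked?)
open import Data.List.Relation.Unary.Unique.Propositional using (Unique)
import Data.List.Relation.Unary.Unique.DecSetoid as DecUnique
open import Data.Nat.Base using (ℕ; zero; suc; _≤_; z≤n; s≤s)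
open import Data.Nat.Properties using (≤-trans; m≤m+n; n≤1+n)
open import Data.Product.Base using (Σ-syntax; ∃-syntax; _×_; _,_; proj₁; proj₂)
open import Data.Sum.Base using (_⊎_; inj₁; inj₂)
open import Data.Unit.Base using (⊤)
open import Function.Bundles using (_↣_; Injection; mk↣)
open import Function.Properties.Inverse using (↔⇒↣)
open import Level using (0ℓ)
open import Relation.Binary.Construct.Closure.Symmetric using (SymClosure)
open import Relation.Binary.Core using (Rel)
open import Relation.Binary.Definitions using (Asymmetric; Decidable)
open import Relation.Binary.PropositionalEquality using (_≡_; _≢_; refl; sym; cong; subst)
open import Relation.Nullary.Decidable using (Dec; map′; _×-dec_; _⊎-dec_; ¬?)
open import Relation.Nullary.Negation using (¬_)

private
  variable
    m n : ℕ

-- Asymmetry excludes both antiparallel arcs and loops.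
record Digraph (n : ℕ) : Set₁ where
  field
    Arc  : Rel (Fin n) 0ℓ
    arc? : Decidable Arc
    asym : Asymmetric Arc

open Digraph public

Adj : Digraph n → Rel (Fin n) 0ℓ
Adj D = SymClosure (Arc D)

-- An induced subgraph with m vertices is given by an enumeration f of its
-- vertices, that is, by an injection f from Fin m.
Induced : Digraph n → Fin m ↣ Fin n → Digraph m
Induced D f = record
  { Arc  = λ u v → Arc D (f.to u) (f.to v)
  ; arc? = λ u v → arc? D (f.to u) (f.to v)
  ; asym = asym D
  }
  where module f = Injection f

-- The vertices of a path are distinct.  For transitive reductions this
-- matters: with walks instead, a directed triangle would lose all its arcs.
IsPath : Rel (Fin n) 0ℓ → List (Fin n) → Set
IsPath R vs = Linked R vs × Unique vs

-- A directed path of length at least 2 from u to v.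
LongPath : Digraph n → Rel (Fin n) 0ℓ
LongPath D u v = ∃[ w ] ∃[ ws ] IsPath (Arc D) (u ∷ w ∷ ws ∷ʳ v)

private
  lookup-injective : ∀ {xs : List (Fin n)} → Unique xs →
                     ∀ {i j} → lookup xs i ≡ lookup xs j → i ≡ j
  lookup-injective (_ ∷ _)       {zero}  {zero}  _  = refl
  lookup-injective (x∉ ∷ _)      {zero}  {suc j} eq = ⊥-elim (All.lookup x∉ (∈-lookup j) eq)
  lookup-injective {xs = x ∷ xs} (x∉ ∷ _) {suc i} {zero} eq =
    ⊥-elim (All.lookup x∉ (subst (_∈ xs) eq (∈-lookup i)) refl)
  lookup-injective (_ ∷ u)       {suc i} {suc j} eq = cong suc (lookup-injective u eq)

  unique⇒length≤ : ∀ {xs : List (Fin n)} → Unique xs → length xs ≤ n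
  unique⇒length≤ u = injective⇒≤ (lookup-injective u)

  bounded? : ∀ k {P : List (Fin n) → Set} → (∀ xs → Dec (P xs)) →
             Dec (∃[ xs ] length xs ≤ k × P xs)
  bounded? zero P? = map′ (λ p → [] , z≤n , p) (λ { ([] , _ , p) → p }) (P? [])
  bounded? (suc k) P? = map′
    (λ { (inj₁ p) → [] , z≤n , p ; (inj₂ (x , xs , l , p)) → x ∷ xs , s≤s l , p })
    (λ { ([] , _ , p) → inj₁ p ; (x ∷ xs , s≤s l , p) → inj₂ (x , xs , l , p) })
    (P? [] ⊎-dec any? (λ x → bounded? k (λ xs → P? (x ∷ xs))))

  isPath? : ∀ (D : Digraph n) vs → Dec (IsPath (Arc D) vs)
  isPath? {n} D vs = linked? (arc? D) vs ×-dec DecUnique.unique? (Fin.≡-decSetoid n) vs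

longPath? : ∀ (D : Digraph n) → Decidable (LongPath D)
longPath? {n} D u v = map′
  (λ { (w , ws , _ , p) → w , ws , p })
  (λ { (w , ws , p) → w , ws , bound w ws p , p })
  (any? (λ w → bounded? n (λ ws → isPath? D (u ∷ w ∷ ws ∷ʳ v))))
  where
  bound : ∀ w ws → IsPath (Arc D) (u ∷ w ∷ ws ∷ʳ v) → length ws ≤ n
  bound w ws (_ , unique) = ≤-trans
    (subst (length ws ≤_) (sym (length-++ ws)) (m≤m+n _ _))
    (≤-trans (≤-trans (n≤1+n _) (n≤1+n _)) (unique⇒length≤ unique))

TransitiveReduction : Digraph n → Digraph n
TransitiveReduction D = record
  { Arc  = λ u v → Arc D u v × ¬ LongPath D u v
  ; arc? = λ u v → arc? D u v ×-dec ¬? (longPath? D u v)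
  ; asym = λ uv vu → asym D (proj₁ uv) (proj₁ vu)
  }

-- A cycle is a path on at least three vertices whose ends are adjacent.
HasCycle : Rel (Fin n) 0ℓ → Set
HasCycle R = ∃[ u ] ∃[ v ] ∃[ ws ] ∃[ w ] IsPath R (u ∷ v ∷ ws ∷ʳ w) × R w u

OrientedForest : Digraph n → Set
OrientedForest D = ¬ HasCycle (Adj D)

Vertebrate : Digraph n → Set
Vertebrate {n} D = ∀ {m} (f : Fin m ↣ Fin n) →
  OrientedForest (TransitiveReduction (Induced D f))

-- The case k = 1 of a path v₁ → ⋯ → vₖ is omitted, as there are no loops v₁ → v₁.
Filled : Digraph n → Set
Filled D = ∀ u ws v → IsPath (Arc D) (u ∷ ws ∷ʳ v) → Arc D u v →
  AllPairs (Arc D) (u ∷ ws ∷ʳ v)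

Skeletal : Digraph n → Set
Skeletal D = Vertebrate D × Filled D

Source Sink Simplicial : Digraph n → Fin n → Set
Source     D x = ∀ u → ¬ Arc D u x
Sink       D x = ∀ u → ¬ Arc D x u
Simplicial D x = ∀ {u v} → Adj D x u → Adj D x v → u ≢ v → Adj D u v

deleteLast : Digraph (suc n) → Digraph n
deleteLast D = Induced D (mk↣ inject₁-injective)

-- The conditions on a labeling, for a digraph whose vertices are their own
-- labels (counted from 0, so that the last label is fromℕ n).
PeoLabeled : Digraph (suc n) → Set
PeoLabeled {zero}  D = ⊤
PeoLabeled {suc n} D =
  (Source D last ⊎ Sink D last) × Simplicial D last × PeoLabeled (deleteLast D)
  where last = fromℕ (suc n)

-- The labeling π sends each label to the vertex carrying it.
PeoConsistent : Digraph (suc n) → Set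
PeoConsistent {n} D = Σ[ π ∈ Permutation′ (suc n) ] PeoLabeled (Induced D (↔⇒↣ π))

{-# OPTIONS --safe #-}

-- In a skeletal digraph a cycle of the underlying graph is impossible if no arc
-- x → y of it has a vertex z of the cycle with x → z → y: by filledness all its
-- arcs would survive in the transitive reduction of the subgraph it induces.
-- Hence there are no directed triangles, the underlying graph is chordal, and
-- a → b → d, a → c → d forces b and c to be adjacent.  Dirac's argument for
-- simplicial vertices of chordal graphs then yields simplicial sources or sinks.
-- The new case is a clique Y = S ∪ C cut off from v by S ⊆ N(v): if both its
-- source s and its sink t were in S, then for c ∈ C the arcs between v and s, t
-- together with s → c → t would make v adjacent to c.

module Submission where

open import Defs
open import Data.Empty using (⊥; ⊥-elim)
open import Data.Fin.Base using (Fin; zero; suc; inject₁; fromℕ; punchIn)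
open import Data.Fin.Permutation using (Permutation; id; insert; insert-punchIn; _⟨$⟩ʳ_)
open import Data.Fin.Properties using (_≟_; punchIn-injective; inject₁-injective)
open import Data.List.Base using (List; []; _∷_; _∷ʳ_; length; lookup; map; filter)
open import Data.List.Membership.Propositional using (_∈_; find; lose)
open import Data.List.Membership.Propositional.Properties
  using (∈-lookup; ∈-allFin; ∈-filter⁺; ∈-filter⁻)
open import Data.List.Properties using (map-++; filter-notAll)
open import Data.List.Relation.Unary.All as All using (All; []; _∷_)
import Data.List.Relation.Unary.All.Properties as All
open import Data.List.Relation.Unary.AllPairs using (AllPairs; []; _∷_)
import Data.List.Relation.Unary.AllPairs.Properties as AllPairs
open import Data.List.Relation.Unary.Any using (Any; here; there; any?; index)
open import Data.List.Relation.Unary.Any.Properties using (lookup-index)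
open import Data.List.Relation.Unary.Linked as Linked using (Linked; [-]; _∷_)
import Data.List.Relation.Unary.Linked.Properties as Linked
open import Data.List.Relation.Unary.Unique.Propositional using (Unique)
import Data.List.Relation.Unary.Unique.Propositional.Properties as Unique
open import Data.Nat.Base using (ℕ; zero; suc; _<_)
open import Data.Nat.Induction using (<-wellFounded)
open import Data.Product.Base using (∃-syntax; _×_; _,_; proj₁; proj₂)
open import Data.Sum.Base as Sum using (_⊎_; inj₁; inj₂; [_,_]′)
open import Data.Unit.Base using (tt)
open import Function.Base using (_∘_; flip)
open import Function.Bundles using (_↣_; Injection; mk↣)
open import Function.Construct.Composition using (_↣-∘_)
open import Function.Properties.Inverse using (↔⇒↣)
open import Induction.WellFounded using (Acc; acc)
open import Level using (0ℓ)
open import Relation.Binary.Construct.Closure.ReflexiveTransitive as Star using (Star; ε; _◅_; _◅◅_)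
open import Relation.Binary.Construct.Closure.Symmetric as Sym using (SymClosure; fwd; bwd)
open import Relation.Binary.Core using (Rel)
open import Relation.Binary.Definitions using (Asymmetric; Decidable)
open import Relation.Binary.PropositionalEquality
  using (_≡_; _≢_; refl; sym; trans; cong; cong₂; subst; subst₂)
open import Relation.Nullary.Decidable using (yes; no; map′; _×-dec_; _⊎-dec_; ¬?; decidable-stable)
open import Relation.Nullary.Negation using (¬_; contradiction)

private
  variable
    m n : ℕ
    A : Set

-- Lists, relations and minimal elements.

lookup-injective : {xs : List A} → Unique xs → ∀ {i j} → lookup xs i ≡ lookup xs j → i ≡ j
lookup-injective (_ ∷ _)  {zero}  {zero}  _  = refl
lookup-injective (x∉ ∷ _) {zero}  {suc j} eq = contradiction eq (All.lookup x∉ (∈-lookup j))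
lookup-injective (x∉ ∷ _) {suc i} {zero}  eq = contradiction (sym eq) (All.lookup x∉ (∈-lookup i))
lookup-injective (_ ∷ u)  {suc i} {suc j} eq = cong suc (lookup-injective u eq)

preimage : {xs ys : List A} → All (_∈ xs) ys → ∃[ is ] map (lookup xs) is ≡ ys
preimage []         = [] , refl
preimage (y∈ ∷ ys∈) = let is , eq = preimage ys∈ in
  index y∈ ∷ is , cong₂ _∷_ (sym (lookup-index y∈)) eq

gmap⁻ : ∀ {A B : Set} {R : Rel A 0ℓ} {S : Rel B 0ℓ} (f : B → A) →
        (∀ {x y} → R (f x) (f y) → S x y) →
        ∀ {x y} → SymClosure R (f x) (f y) → SymClosure S x y
gmap⁻ f R⇒S (fwd r) = fwd (R⇒S r)
gmap⁻ f R⇒S (bwd r) = bwd (R⇒S r)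

linked-tail : ∀ {R : Rel A 0ℓ} {P : A → Set} {x xs} →
              Linked R (x ∷ xs) → All P xs → Linked (λ y z → R y z × P z) (x ∷ xs)
linked-tail [-]      []       = [-]
linked-tail (r ∷ rs) (p ∷ ps) = (r , p) ∷ linked-tail rs ps

-- Transitivity is asked only for ends in the list, since arcs compose only when the ends are near
-- each other. If `x` precedes the minimal `s` of the tail, whatever in the tail precedes `x` would
-- precede `s`.
minimal : ∀ {R : Rel A 0ℓ} → Asymmetric R → Decidable R → ∀ x xs →
          (∀ {a b c} → a ∈ x ∷ xs → c ∈ x ∷ xs → R a b → R b c → R a c) →
          ∃[ y ] y ∈ x ∷ xs × (∀ {z} → z ∈ x ∷ xs → ¬ R z y)
minimal asym R? x []       _     = x , here refl , λ { (here refl) r → asym r r }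
minimal asym R? x (y ∷ ys) trans
  with s , s∈ , min ← minimal asym R? y ys (λ a c → trans (there a) (there c))
  with R? x s
... | no ¬xs = s , there s∈ , λ { (here refl) → ¬xs ; (there z∈) → min z∈ }
... | yes xs = x , here refl , λ
  { (here refl) r → asym r r
  ; (there z∈) r → min z∈ (trans (there z∈) (there s∈) r xs) }

-- Induced subgraphs and cycles that survive the transitive reduction.

skeletal-induced : ∀ (D : Digraph n) (f : Fin m ↣ Fin n) → Skeletal D → Skeletal (Induced D f)
skeletal-induced D f (vertebrate , filled) = (λ g → vertebrate (f ↣-∘ g)) , filled′
  where
  open Injection f using (to; injective)
  filled′ : Filled (Induced D f)
  filled′ u ws v (linked , unique) uv = AllPairs.map⁻ (subst (AllPairs (Arc D)) (sym eq)
    (filled (to u) (map to ws) (to v)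
      ( subst (Linked (Arc D)) eq (Linked.map⁺ linked)
      , subst Unique eq (Unique.map⁺ injective unique)) uv))
    where
    eq : map to (u ∷ ws ∷ʳ v) ≡ to u ∷ map to ws ∷ʳ to v
    eq = cong (to u ∷_) (map-++ to ws (v ∷ []))

-- Filledness gives the arc from the first inner vertex of the long path to its end. Hence the
-- transitive reduction of a filled digraph drops an arc only if two arcs bypass it.
between : (D : Digraph n) → Filled D → ∀ {u v} → LongPath D u v → Arc D u v →
          ∃[ w ] Arc D u w × Arc D w v
between D filled (w , ws , path) uv with filled _ (w ∷ ws) _ path uv
... | (uw ∷ _) ∷ (w→ ∷ _) = w , uw , proj₂ (All.∷ʳ⁻ {xs = ws} w→)

module _ (D : Digraph n) where

  -- Between entries of `xs`, in a filled digraph, these are the arcs kept by the transitive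
  -- reduction of the subgraph induced on `xs`.
  Covers : List (Fin n) → Rel (Fin n) 0ℓ
  Covers xs x y = Arc D x y × (∀ {z} → z ∈ xs → Arc D x z → ¬ Arc D z y)

  -- The positions in `c` enumerate the subgraph induced on the cycle. Pulled back along `lookup c`,
  -- the cycle lies in the transitive reduction, against `Vertebrate`.
  no-covering-cycle : Skeletal D → ∀ u v ws w → let c = u ∷ v ∷ ws ∷ʳ w in
    Unique c → Linked (SymClosure (Covers c)) c → ¬ SymClosure (Covers c) w u
  no-covering-cycle skeletal u v ws w unique linked wu =
    proj₁ skeletal f (index u∈ , index v∈ , is , index w∈ ,
      ( Linked.map (gmap⁻ (lookup c) cover) (Linked.map⁻ (subst (Linked _) (sym eq) linked))
      , Unique.map⁻ (subst Unique (sym eq) unique)) ,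
      gmap⁻ (lookup c) cover (subst₂ (SymClosure (Covers c)) (lookup-index w∈) (lookup-index u∈) wu))
    where
    c = u ∷ v ∷ ws ∷ʳ w

    f : Fin (length c) ↣ Fin n
    f = mk↣ (lookup-injective unique)

    c∈ : All (_∈ c) c
    c∈ = All.tabulate (λ x∈ → x∈)
    u∈ = All.head c∈
    v∈ = All.head (All.tail c∈)
    ws∈ = proj₁ (All.∷ʳ⁻ {xs = ws} (All.tail (All.tail c∈)))
    w∈ = proj₂ (All.∷ʳ⁻ {xs = ws} (All.tail (All.tail c∈)))
    is = proj₁ (preimage ws∈)

    eq : map (lookup c) (index u∈ ∷ index v∈ ∷ is ∷ʳ index w∈) ≡ c
    eq = cong₂ _∷_ (sym (lookup-index u∈)) (cong₂ _∷_ (sym (lookup-index v∈))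
      (trans (map-++ (lookup c) is (index w∈ ∷ [])) (cong₂ _∷ʳ_ (proj₂ (preimage ws∈)) (sym (lookup-index w∈)))))

    cover : ∀ {i j} → Covers c (lookup c i) (lookup c j) →
            Arc (TransitiveReduction (Induced D f)) i j
    cover (arc , none) = arc , λ path →
      let k , ik , kj = between (Induced D f) (proj₂ (skeletal-induced D f skeletal)) path arc in
      none (∈-lookup k) ik kj

-- Adjacency, directed triangles and diamonds.

module _ (D : Digraph n) (skeletal : Skeletal D) where

  private
    infix 4 _~_
    _~_ : Rel (Fin n) 0ℓ
    _~_ = Adj D

  Near Far : Rel (Fin n) 0ℓ
  Near x y = x ≡ y ⊎ x ~ y
  Far  x y = ¬ Near x y

  adj? : Decidable _~_
  adj? x y = map′ [ fwd , bwd ]′ (λ { (fwd xy) → inj₁ xy ; (bwd yx) → inj₂ yx })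
    (arc? D x y ⊎-dec arc? D y x)

  near? : Decidable Near
  near? x y = (x ≟ y) ⊎-dec adj? x y

  adj-sym : ∀ {x y} → x ~ y → y ~ x
  adj-sym = Sym.symmetric (Arc D)

  near-sym : ∀ {x y} → Near x y → Near y x
  near-sym = Sum.map sym adj-sym

  arc-irrefl : ∀ {x} → ¬ Arc D x x
  arc-irrefl xx = asym D xx xx

  adj-irrefl : ∀ {x} → ¬ x ~ x
  adj-irrefl (fwd xx) = arc-irrefl xx
  adj-irrefl (bwd xx) = arc-irrefl xx

  arc⇒≢ : ∀ {x y} → Arc D x y → x ≢ y
  arc⇒≢ xy refl = arc-irrefl xy

  -- A bypass of one arc through the third vertex would reverse another arc, so the reduction keeps
  -- the whole triangle.
  no-triangle : ∀ {a b c} → Arc D a b → Arc D b c → ¬ Arc D c a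
  no-triangle {a} {b} {c} ab bc ca = no-covering-cycle D skeletal a b [] c
    ((arc⇒≢ ab ∷ arc⇒≢ ca ∘ sym ∷ []) ∷ (arc⇒≢ bc ∷ []) ∷ [] ∷ [])
    (fwd (ab , λ { (here refl) r _ → arc-irrefl r
                 ; (there (here refl)) _ r → arc-irrefl r
                 ; (there (there (here refl))) r _ → asym D ca r })
    ∷ fwd (bc , λ { (here refl) r _ → asym D ab r
                  ; (there (here refl)) r _ → arc-irrefl r
                  ; (there (there (here refl))) _ r → arc-irrefl r })
    ∷ [-])
    (fwd (ca , λ { (here refl) _ r → arc-irrefl r
                 ; (there (here refl)) r _ → asym D bc r
                 ; (there (there (here refl))) r _ → arc-irrefl r }))

  -- The opposite arc would close a directed triangle, and equal ends would make the two arcs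
  -- antiparallel.
  near-trans : ∀ {a b c} → Near a c → Arc D a b → Arc D b c → Arc D a c
  near-trans (inj₁ refl)     ab bc = ⊥-elim (asym D ab bc)
  near-trans (inj₂ (fwd ac)) ab bc = ac
  near-trans (inj₂ (bwd ca)) ab bc = ⊥-elim (no-triangle ab bc ca)

  -- Consider the four-cycle `a`, `b`, `d`, `c`. It may have the chord between `a` and `d`, but a
  -- bypass using that chord would reverse an arc of the cycle; every other bypass needs an arc
  -- between `b` and `c`.
  diamond : ∀ {a b c d} → Arc D a b → Arc D b d → Arc D a c → Arc D c d → Near b c
  diamond {a} {b} {c} {d} ab bd ac cd = decidable-stable (near? b c) λ far →
    let b↛c = λ r → far (inj₂ (fwd r))
        c↛b = λ r → far (inj₂ (bwd r)) in
    no-covering-cycle D skeletal a b (d ∷ []) c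
    ((arc⇒≢ ab ∷ (λ { refl → asym D ab bd }) ∷ arc⇒≢ ac ∷ []) ∷ (arc⇒≢ bd ∷ far ∘ inj₁ ∷ [])
      ∷ (arc⇒≢ cd ∘ sym ∷ []) ∷ [] ∷ [])
    (fwd (ab , λ { (here refl) r _ → arc-irrefl r
                 ; (there (here refl)) _ r → arc-irrefl r
                 ; (there (there (here refl))) _ r → asym D bd r
                 ; (there (there (there (here refl)))) _ r → c↛b r })
    ∷ fwd (bd , λ { (here refl) r _ → asym D ab r
                  ; (there (here refl)) r _ → arc-irrefl r
                  ; (there (there (here refl))) _ r → arc-irrefl r
                  ; (there (there (there (here refl)))) r _ → b↛c r })
    ∷ bwd (cd , λ { (here refl) r _ → asym D ac r
                  ; (there (here refl)) r _ → c↛b r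
                  ; (there (there (here refl))) _ r → arc-irrefl r
                  ; (there (there (there (here refl)))) r _ → arc-irrefl r })
    ∷ [-])
    (bwd (ac , λ { (here refl) r _ → arc-irrefl r
                 ; (there (here refl)) _ r → b↛c r
                 ; (there (there (here refl))) _ r → asym D cd r
                 ; (there (there (there (here refl)))) _ r → arc-irrefl r }))

  -- Chordless paths and chordality.

  NoCommon : List (Fin n) → Rel (Fin n) 0ℓ
  NoCommon xs x y = x ~ y × All (λ z → x ~ z → ¬ z ~ y) xs

  -- A bypass of an arc is a common neighbour of its ends. The undirected condition thus suffices
  -- for cycles whose orientation is unknown.
  noCommon⇒covers : ∀ {xs x y} → NoCommon xs x y → SymClosure (Covers D xs) x y
  noCommon⇒covers (fwd xy , none) = fwd (xy , λ z∈ xz zy → All.lookup none z∈ (fwd xz) (fwd zy))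
  noCommon⇒covers (bwd yx , none) = bwd (yx , λ z∈ yz zx → All.lookup none z∈ (bwd zx) (bwd yz))

  module _ (v : Fin n) where

    -- Path t x ws: x ∷ ws ∷ʳ t is a chordless path whose interior ws avoids
    -- the closed neighbourhood of v.
    data Path (t : Fin n) : Fin n → List (Fin n) → Set where
      edge : ∀ {x} → x ~ t → Path t x []
      step : ∀ {x y ws} → x ~ y → Far v y → All (Far x) (ws ∷ʳ t) → Path t y ws →
             Path t x (y ∷ ws)

    -- Shortcut from x to the last neighbour of x on the path.
    connect : ∀ {t x} → Far x t → ∀ {y ws} → Far v y → Path t y ws → Any (Near x) (y ∷ ws) →
              ∃[ us ] Path t x us
    connect xt vy p (here (inj₁ refl)) = _ , p
    connect xt vy p@(edge _) (here (inj₂ xy)) = _ , step xy vy (xt ∷ []) p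
    connect {x = x} xt {ws = z ∷ ws} vy p@(step _ vz _ q) (here (inj₂ xy))
      with any? (near? x) (z ∷ ws)
    ... | yes near = connect xt vz q near
    ... | no ¬near = _ , step xy vy (All.∷ʳ⁺ (All.¬Any⇒All¬ _ ¬near) xt) p
    connect xt vy (step _ vz _ q) (there near) = connect xt vz q near

    extend : ∀ {t x y ws} → x ≢ t → x ~ y → Far v y → Path t y ws → ∃[ us ] Path t x us
    extend {t} {x} x≢t xy vy p with near? x t
    ... | yes (inj₁ x≡t) = contradiction x≡t x≢t
    ... | yes (inj₂ xt)  = _ , edge xt
    ... | no  xt         = connect xt vy p (here (inj₂ xy))

    Step : Rel (Fin n) 0ℓ
    Step x y = x ~ y × Far v x × Far v y

    step-sym : ∀ {x y} → Step x y → Step y x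
    step-sym (xy , vx , vy) = adj-sym xy , vy , vx

    walk⇒path : ∀ {t x y} → v ~ t → Star Step x y → y ~ t → ∃[ ws ] Path t x ws
    walk⇒path vt ε yt = _ , edge yt
    walk⇒path vt ((xz , vx , vz) ◅ walk) yt =
      extend (λ { refl → vx (inj₂ vt) }) xz vz (proj₂ (walk⇒path vt walk yt))

    interior-far : ∀ {t x ws} → Path t x ws → All (Far v) ws
    interior-far (edge _) = []
    interior-far (step _ vy _ p) = vy ∷ interior-far p

    path-unique : ∀ {t x ws} → Path t x ws → Unique (x ∷ ws ∷ʳ t)
    path-unique (edge xt) = ((λ { refl → adj-irrefl xt }) ∷ []) ∷ [] ∷ []
    path-unique (step xy _ far p) =
      ((λ { refl → adj-irrefl xy }) ∷ All.map (_∘ inj₁) far) ∷ path-unique p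

    -- The edge entered by a `step` has an end far from `v`, so `v` is no common neighbour. Only a
    -- path that is a single edge could have both ends adjacent to `v`; `ends` excludes this.
    path-linked : ∀ {t x ws} → ¬ v ~ x ⊎ ¬ x ~ t → Path t x ws →
                  Linked (NoCommon (v ∷ x ∷ ws ∷ʳ t)) (x ∷ ws ∷ʳ t)
    path-linked ends (edge xt) =
      (xt , (λ xv _ → [ (λ ¬vx → ¬vx (adj-sym xv)) , (λ ¬xt → ¬xt xt) ]′ ends)
          ∷ (λ xx _ → adj-irrefl xx) ∷ (λ _ tt → adj-irrefl tt) ∷ []) ∷ [-]
    path-linked _ (step xy vy far p) =
      (xy , (λ _ → vy ∘ inj₂) ∷ (λ xx _ → adj-irrefl xx) ∷ (λ _ yy → adj-irrefl yy)
          ∷ All.map (λ xz r _ → xz (inj₂ r)) far)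
      -- The second end `b` of every later edge is far from `x`, so `x` can be added to the list of
      -- excluded common neighbours.
      ∷ Linked.map (λ { ((ab , v∌ ∷ none) , xb) → ab , v∌ ∷ (λ _ → xb ∘ inj₂) ∷ none })
          (linked-tail (path-linked (inj₁ (vy ∘ inj₂)) p) far)

    -- Closing the path through `v` gives an induced cycle on at least four vertices. No edge of it
    -- has a common neighbour on it, so all its edges survive.
    no-chordless-cycle : ∀ {s t ws} → v ~ s → v ~ t → Far s t → ¬ Path t s ws
    no-chordless-cycle {s} {t} {ws} vs vt st p = no-covering-cycle D skeletal v s ws t
      (((λ { refl → adj-irrefl vs }) ∷ All.∷ʳ⁺ (All.map (_∘ inj₁) (interior-far p))
                                              (λ { refl → adj-irrefl vt }))
        ∷ path-unique p)
      (noCommon⇒covers (vs , (λ vv _ → adj-irrefl vv) ∷ (λ _ ss → adj-irrefl ss)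
          ∷ All.∷ʳ⁺ (All.map (λ vz r _ → vz (inj₂ r)) (interior-far p))
                    (λ _ ts → st (inj₂ (adj-sym ts))))
        ∷ Linked.map noCommon⇒covers (path-linked (inj₂ (st ∘ inj₂)) p))
      (noCommon⇒covers (adj-sym vt , (λ _ vv → adj-irrefl vv) ∷ (λ ts _ → st (inj₂ (adj-sym ts)))
          ∷ All.∷ʳ⁺ (All.map (λ vz _ r → vz (inj₂ (adj-sym r))) (interior-far p))
                    (λ tt _ → adj-irrefl tt)))

    -- Otherwise the walk outside the closed neighbourhood of `v` shrinks to a chordless path from
    -- `s` to `t`. This makes the separator in Dirac's argument a clique.
    attachments-near : ∀ {s t c d} → v ~ s → v ~ t → s ~ c → Far v c → Star Step c d → d ~ t → Near s t
    attachments-near {s} {t} vs vt sc vc walk dt = decidable-stable (near? s t) λ st →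
      no-chordless-cycle vs vt st
        (proj₂ (extend (st ∘ inj₁) sc vc (proj₂ (walk⇒path vt walk dt))))

    -- Components outside a closed neighbourhood.

    module _ (c₀ : Fin n) where

      Reached : Fin n → Set
      Reached c = Far v c × Star Step c₀ c

      -- Closure is relative to `X`, whereas the walks behind `Reached` may leave `X`: chordality
      -- holds in all of `D`.
      IsComponent : List (Fin n) → List (Fin n) → Set
      IsComponent X C = c₀ ∈ C × All Reached C ×
        (∀ {y} → y ∈ X → Far v y → Any (Near y) C → y ∈ C)

      component : ∀ X → Far v c₀ → ∃[ C ] IsComponent X C
      component X vc₀ = grow X (<-wellFounded _) (c₀ ∷ []) (here refl) ((vc₀ , ε) ∷ []) inj₂
        where
        -- `C` and `R` together cover `X`. Each round moves a vertex `r` far from `v` and adjacent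
        -- to `C` from `R` to `C`, so `R` gets shorter.
        grow : ∀ R → Acc _<_ (length R) → ∀ C → c₀ ∈ C → All Reached C →
               (∀ {y} → y ∈ X → y ∈ C ⊎ y ∈ R) → ∃[ C ] IsComponent X C
        grow R (acc rec) C c₀∈ reached cover
          with any? (λ r → ¬? (near? v r) ×-dec any? (adj? r) C) R
        ... | no none = C , c₀∈ , reached , λ y∈X vy near → [ (λ y∈C → y∈C) , closed vy near ]′ (cover y∈X)
          where
          closed : ∀ {y} → Far v y → Any (Near y) C → y ∈ R → y ∈ C
          closed vy near y∈R with find near
          ... | c , c∈C , inj₁ refl = c∈C
          ... | c , c∈C , inj₂ yc   = contradiction (lose y∈R (vy , lose c∈C yc)) none
        ... | yes new with r , r∈R , vr , near ← find new with c , c∈C , rc ← find near =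
          let vc , walk = All.lookup reached c∈C in
          grow (filter (λ y → ¬? (r ≟ y)) R)
            (rec (filter-notAll (λ y → ¬? (r ≟ y)) R (lose r∈R (λ r≢r → r≢r refl))))
            (r ∷ C) (there c₀∈) ((vr , walk ◅◅ (adj-sym rc , vc , vr) ◅ ε) ∷ reached)
            (λ y∈X → [ inj₁ ∘ there , split ]′ (cover y∈X))
          where
          split : ∀ {y} → y ∈ R → y ∈ r ∷ C ⊎ y ∈ filter (λ y → ¬? (r ≟ y)) R
          split {y} y∈R with r ≟ y
          ... | yes refl = inj₁ (here refl)
          ... | no r≢y   = inj₂ (∈-filter⁺ _ y∈R r≢y)

  -- Simplicial sources and sinks.

  SimplicialEnd : List (Fin n) → Fin n → Set
  SimplicialEnd X w = w ∈ X
    × ((∀ {u} → u ∈ X → ¬ Arc D u w) ⊎ (∀ {u} → u ∈ X → ¬ Arc D w u))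
    × (∀ {x y} → x ∈ X → y ∈ X → w ~ x → w ~ y → Near x y)

  -- The conditions on `w` involve only its neighbours. As they are relative to a list, the
  -- recursion passes to subgraphs without renaming vertices.
  good-lift : ∀ {X Y w} → w ∈ X → (∀ {u} → u ∈ X → Near u w → u ∈ Y) → SimplicialEnd Y w → SimplicialEnd X w
  good-lift w∈X N⊆Y (_ , ends , simplicial) = w∈X ,
    Sum.map (λ source u∈ uw → source (N⊆Y u∈ (inj₂ (fwd uw))) uw)
            (λ sink u∈ wu → sink (N⊆Y u∈ (inj₂ (bwd wu))) wu) ends ,
    λ x∈ y∈ wx wy → simplicial (N⊆Y x∈ (inj₂ (adj-sym wx))) (N⊆Y y∈ (inj₂ (adj-sym wy))) wx wy

  Clique : List (Fin n) → Set
  Clique X = ∀ {x y} → x ∈ X → y ∈ X → Near x y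

  clique-source : ∀ {X x} → x ∈ X → Clique X → ∃[ s ] s ∈ X × (∀ {u} → u ∈ X → ¬ Arc D u s)
  clique-source {x ∷ xs} _ clique =
    minimal (asym D) (arc? D) x xs (λ a∈ c∈ → near-trans (clique a∈ c∈))

  clique-sink : ∀ {X x} → x ∈ X → Clique X → ∃[ s ] s ∈ X × (∀ {u} → u ∈ X → ¬ Arc D s u)
  clique-sink {x ∷ xs} _ clique =
    minimal (asym D) (flip (arc? D)) x xs
      (λ a∈ c∈ ba cb → near-trans (clique c∈ a∈) cb ba)

  clique-or-far : ∀ X → Clique X ⊎ ∃[ x ] x ∈ X × Any (Far x) X
  clique-or-far X with any? (λ x → any? (λ y → ¬? (near? x y)) X) X
  ... | yes far = inj₂ (find far)
  ... | no ¬far = inj₁ λ {x} {y} x∈ y∈ →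
    decidable-stable (near? x y) λ xy → ¬far (lose x∈ (lose y∈ xy))

  private
    -- If the arcs joining `v` to `s` and `t` both leave or both enter `v`, filledness of a path on
    -- all four vertices joins `v` to `c`. Otherwise they form a directed triangle with `s → t` or a
    -- diamond with `s → c → t`.
    no-clique-end-near : ∀ {s c t v} → Arc D s c → Arc D c t → Near s t →
                         Far v c → Near v s → Near v t → ⊥
    no-clique-end-near sc ct st vc (inj₁ refl) vt = vc (inj₂ (fwd sc))
    no-clique-end-near sc ct st vc (inj₂ vs) (inj₁ refl) = vc (inj₂ (bwd ct))
    no-clique-end-near {s} {c} {t} {v} sc ct st vc (inj₂ (fwd vs)) (inj₂ (fwd vt))
      with proj₂ skeletal v (s ∷ c ∷ []) t
        ( vs ∷ sc ∷ ct ∷ [-]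
        , (arc⇒≢ vs ∷ vc ∘ inj₁ ∷ arc⇒≢ vt ∷ []) ∷ (arc⇒≢ sc ∷ arc⇒≢ (near-trans st sc ct) ∷ [])
            ∷ (arc⇒≢ ct ∷ []) ∷ [] ∷ []) vt
    ... | (_ ∷ v→c ∷ _) ∷ _ = vc (inj₂ (fwd v→c))
    no-clique-end-near sc ct st vc (inj₂ (fwd vs)) (inj₂ (bwd tv)) =
      no-triangle vs (near-trans st sc ct) tv
    no-clique-end-near sc ct st vc (inj₂ (bwd sv)) (inj₂ (fwd vt)) = vc (diamond sv vt sc ct)
    no-clique-end-near {s} {c} {t} {v} sc ct st vc (inj₂ (bwd sv)) (inj₂ (bwd tv))
      with proj₂ skeletal s (c ∷ t ∷ []) v
        ( sc ∷ ct ∷ tv ∷ [-]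
        , (arc⇒≢ sc ∷ arc⇒≢ (near-trans st sc ct) ∷ arc⇒≢ sv ∷ [])
            ∷ (arc⇒≢ ct ∷ vc ∘ inj₁ ∘ sym ∷ []) ∷ (arc⇒≢ tv ∷ []) ∷ [] ∷ []) sv
    ... | _ ∷ (_ ∷ c→v ∷ _) ∷ _ = vc (inj₂ (bwd c→v))

  -- All vertices of a clique are simplicial, so its source and its sink are the candidates. If both
  -- are near `v`, then `c` differs from both and lies between them.
  clique-end-far : ∀ {X c v} → Clique X → c ∈ X → Far v c → ∃[ w ] SimplicialEnd X w × Far v w
  clique-end-far {X} {c} {v} clique c∈ vc
    with s , s∈ , source ← clique-source c∈ clique
    with t , t∈ , sink ← clique-sink c∈ clique
    with near? v s | near? v t
  ... | no vs | _ = s , (s∈ , inj₁ source , λ x∈ y∈ _ _ → clique x∈ y∈) , vs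
  ... | yes _ | no vt = t , (t∈ , inj₂ sink , λ x∈ y∈ _ _ → clique x∈ y∈) , vt
  ... | yes vs | yes vt = ⊥-elim (no-clique-end-near sc ct (clique s∈ t∈) vc vs vt)
    where
    sc : Arc D s c
    sc with clique s∈ c∈
    ... | inj₁ refl = contradiction vs vc
    ... | inj₂ (fwd sc) = sc
    ... | inj₂ (bwd cs) = contradiction cs (source c∈)
    ct : Arc D c t
    ct with clique c∈ t∈
    ... | inj₁ refl = contradiction vt vc
    ... | inj₂ (fwd ct) = ct
    ... | inj₂ (bwd tc) = contradiction tc (sink c∈)

  -- Let C be a component of X ∖ N[v] and Y = N[C] ∩ X.  Then Y ∖ C ⊆ N(v) is a
  -- clique, and a simplicial end of Y that lies in C is one of X.
  far-good : ∀ X → Acc _<_ (length X) → ∀ {v} → v ∈ X → Any (Far v) X → ∃[ w ] SimplicialEnd X w × Far v w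
  far-good X (acc rec) {v} v∈X far
    with c₀ , c₀∈X , vc₀ ← find far
    with C , c₀∈C , reached , closed ← component v c₀ X vc₀ = by-cases (clique-or-far Y)
    where
    near-C? = λ x → any? (near? x) C
    Y = filter near-C? X

    -- All of `C` is far from `v`, so `v` itself drops out of `Y`.
    Y<X : length Y < length X
    Y<X = filter-notAll near-C? X (lose v∈X λ near →
      let c , c∈C , vc = find near in proj₁ (All.lookup reached c∈C) vc)

    lift : ∀ {w} → SimplicialEnd Y w × Far v w → SimplicialEnd X w × Far v w
    lift (good@(w∈Y , _) , vw) = good-lift w∈X N⊆Y good , vw
      where
      w∈X = proj₁ (∈-filter⁻ near-C? w∈Y)
      w∈C = closed w∈X vw (proj₂ (∈-filter⁻ near-C? {xs = X} w∈Y))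
      N⊆Y : ∀ {u} → u ∈ X → Near u _ → u ∈ Y
      N⊆Y u∈X uw = ∈-filter⁺ near-C? u∈X (lose w∈C uw)

    attachment : ∀ {s} → s ∈ Y → Near v s → v ~ s × ∃[ c ] s ~ c × Reached v c₀ c
    attachment s∈Y vs with find (proj₂ (∈-filter⁻ near-C? {xs = X} s∈Y))
    attachment s∈Y vs          | c , c∈C , inj₁ refl = contradiction vs (proj₁ (All.lookup reached c∈C))
    attachment s∈Y (inj₁ refl) | c , c∈C , inj₂ sc   = contradiction (inj₂ sc) (proj₁ (All.lookup reached c∈C))
    attachment s∈Y (inj₂ vs)   | c , c∈C , inj₂ sc   = vs , c , sc , All.lookup reached c∈C

    boundary-near : ∀ {s t} → s ∈ Y → t ∈ Y → Near v s → Near v t → Near s t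
    boundary-near s∈Y t∈Y vs vt =
      let vs , c , sc , vc , c₀c = attachment s∈Y vs
          vt , d , td , _  , c₀d = attachment t∈Y vt
      in attachments-near v vs vt sc vc (Star.reverse (step-sym v) c₀c ◅◅ c₀d) (adj-sym td)

    by-cases : Clique Y ⊎ ∃[ y ] y ∈ Y × Any (Far y) Y → ∃[ w ] SimplicialEnd X w × Far v w
    by-cases (inj₁ clique) =
      let w , good = clique-end-far clique
            (∈-filter⁺ near-C? c₀∈X (lose c₀∈C (inj₁ refl))) vc₀
      in w , lift good
    by-cases (inj₂ (y , y∈Y , far-y))
      with w , good@(w∈Y , _) , yw ← far-good Y (rec Y<X) y∈Y far-y
      with near? v w
    ... | no vw = w , lift (good , vw)
    -- Here `w` lies in the separator. As `y` is far from `w`, the recursion at `w` yields a second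
    -- end `w′` far from `w`; it avoids the separator, whose vertices are pairwise near.
    ... | yes vw
      with w′ , good′@(w′∈Y , _) , ww′ ← far-good Y (rec Y<X) w∈Y (lose y∈Y (yw ∘ near-sym)) =
      w′ , lift (good′ , λ vw′ → ww′ (boundary-near w∈Y w′∈Y vw vw′))

  good-vertex : ∀ {X x} → x ∈ X → ∃[ w ] SimplicialEnd X w
  good-vertex {X} x∈X with clique-or-far X
  ... | inj₁ clique = let s , s∈ , source = clique-source x∈X clique in
    s , s∈ , inj₁ source , λ a∈ b∈ _ _ → clique a∈ b∈
  ... | inj₂ (y , y∈X , far) = let w , good , _ = far-good X (<-wellFounded _) y∈X far in w , good

  simplicial-end : Fin n → ∃[ w ] (Source D w ⊎ Sink D w) × Simplicial D w
  simplicial-end x = let w , _ , ends , simplicial = good-vertex (∈-allFin x) in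
    w , Sum.map (λ source u → source (∈-allFin u)) (λ sink u → sink (∈-allFin u)) ends ,
    λ wu wv u≢v → [ (λ u≡v → contradiction u≡v u≢v) , (λ uv → uv) ]′
      (simplicial (∈-allFin _) (∈-allFin _) wu wv)

-- From simplicial ends to a labeling.

record _≅_ (D E : Digraph n) : Set where
  field
    ⇒ : ∀ {u v} → Arc D u v → Arc E u v
    ⇐ : ∀ {u v} → Arc E u v → Arc D u v

-- Pointwise equal enumerations induce digraphs with the same arcs that need not be equal as
-- records, so labelings are carried along `_≅_`.
PeoLabeled-resp-≅ : {D E : Digraph (suc n)} → D ≅ E → PeoLabeled D → PeoLabeled E
PeoLabeled-resp-≅ {zero}  D≅E _ = tt
PeoLabeled-resp-≅ {suc n} D≅E (ends , simplicial , rest) =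
  Sum.map (λ source u → source u ∘ ⇐) (λ sink u → sink u ∘ ⇐) ends ,
  (λ xu xv u≢v → Sym.map ⇒ (simplicial (Sym.map ⇐ xu) (Sym.map ⇐ xv) u≢v)) ,
  PeoLabeled-resp-≅ (record { ⇒ = ⇒ ; ⇐ = ⇐ }) rest
  where open _≅_ D≅E

Induced-cong : ∀ (D : Digraph n) (f g : Fin m ↣ Fin n) →
               (∀ i → Injection.to f i ≡ Injection.to g i) → Induced D f ≅ Induced D g
Induced-cong D f g f≗g = record
  { ⇒ = subst₂ (Arc D) (f≗g _) (f≗g _)
  ; ⇐ = subst₂ (Arc D) (sym (f≗g _)) (sym (f≗g _))
  }

insert-same : ∀ i j (π : Permutation m n) → insert i j π ⟨$⟩ʳ i ≡ j
insert-same i j π with i ≟ i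
... | yes _  = refl
... | no i≢i = contradiction refl i≢i

punchIn-fromℕ : (i : Fin n) → punchIn (fromℕ n) i ≡ inject₁ i
punchIn-fromℕ zero    = refl
punchIn-fromℕ (suc i) = cong suc (punchIn-fromℕ i)

lemma25 : ∀ (n : ℕ) (D : Digraph (suc n)) → Skeletal D → PeoConsistent D
lemma25 zero    D skeletal = id , tt
lemma25 (suc n) D skeletal
  with x , ends , simplicial ← simplicial-end D skeletal zero
  -- Delete `x` by enumerating the other vertices with `punchIn x`, and label the rest by induction;
  -- `σ` then gives `x` the last label.
  with π , labeled ← lemma25 n (Induced D (mk↣ (punchIn-injective x _ _)))
                       (skeletal-induced D (mk↣ (punchIn-injective x _ _)) skeletal) =
  σ ,
  Sum.map (λ source u → subst (λ y → ¬ Arc D (σ ⟨$⟩ʳ u) y) (sym σ-last) (source _))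
          (λ sink u → subst (λ y → ¬ Arc D y (σ ⟨$⟩ʳ u)) (sym σ-last) (sink _)) ends ,
  simplicial′ ,
  -- Deleting the last label after applying `σ` enumerates the vertices other than `x` just as `π`
  -- followed by `punchIn x` does.
  PeoLabeled-resp-≅ (Induced-cong D (mk↣ (punchIn-injective x _ _) ↣-∘ ↔⇒↣ π)
                                  (↔⇒↣ σ ↣-∘ mk↣ inject₁-injective) σ-inject₁) labeled
  where
  last = fromℕ (suc n)
  σ = insert last x π

  σ-last : σ ⟨$⟩ʳ last ≡ x
  σ-last = insert-same last x π

  σ-inject₁ : ∀ i → punchIn x (π ⟨$⟩ʳ i) ≡ σ ⟨$⟩ʳ inject₁ i
  σ-inject₁ i = trans (sym (insert-punchIn last x π i)) (cong (σ ⟨$⟩ʳ_) (punchIn-fromℕ i))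

  simplicial′ : Simplicial (Induced D (↔⇒↣ σ)) last
  simplicial′ xu xv u≢v = gmap⁻ (σ ⟨$⟩ʳ_) (λ r → r)
    (simplicial (push xu) (push xv) (u≢v ∘ Injection.injective (↔⇒↣ σ)))
    where
    push : ∀ {u} → Adj (Induced D (↔⇒↣ σ)) last u → Adj D x (σ ⟨$⟩ʳ u)
    push {u} = subst (λ y → Adj D y (σ ⟨$⟩ʳ u)) σ-last ∘ Sym.gmap (σ ⟨$⟩ʳ_) (λ r → r)
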